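{- Let $\mathcal{H}=(V,E)$ be a loopless hypergraph such that $\mathrm{ar}(\mathcal{H})\ge\sqrt{\Delta([\mathcal{H}]_2)+1}$. Then $\mathrm{q}(\mathcal{H})\le\Delta([\mathcal{H}]_2)+1$.
   Context: A hypergraph $\mathcal{H}=(V,E)$ consists of a finite nonempty set $V$ of vertices and a nonempty set $E$ of nonempty subsets of $V$, called hyperedges. It is not assumed to be linear, i.e. two distinct hyperedges may share more than one vertex. A loop is a hyperedge $e$ with $|e|=1$; $\mathcal{H}$ is loopless if it has no loop. The antirank of $\mathcal{H}$ is $\mathrm{ar}(\mathcal{H})=\min_{e\in E}|e|$. The 2-section of $\mathcal{H}$ is the loopless multigraph $[\mathcal{H}]_2$ with vertex set $V$ in which two distinct vertices $x,y$ are joined by exactly $m$ parallel edges, where $m$ is the number of hyperedges of $\mathcal{H}$ containing both $x$ and $y$. $\Delta([\mathcal{H}]_2)$ denotes the maximum degree of this multigraph, with edges counted with multiplicity; thus the degree of $x$ in $[\mathcal{H}]_2$ is $\sum_{e\in E,\ x\in e}(|e|-1)$. The chromatic index $\mathrm{q}(\mathcal{H})$ is the least integer $q$ such that there exists a map $c:E\to\{1,2,\dots,q\}$ satisfying: for all $e,e'\in E$, $c(e)=c(e')$ implies $e\cap e'=\varnothing$ or $e=e'$. -}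

module Defs where

open import Algebra.Properties.CommutativeMonoid.Sum
open import Data.Bool.Properties using () renaming (_≟_ to _≟ᵇ_)
open import Data.Empty using (⊥-elim)
open import Data.Fin.Base using (Fin; finToFun; funToFin)
open import Data.Fin.Properties using (all?; any?; finToFun-funToFin)
  renaming (_≟_ to _≟ᶠ_)
open import Data.Fin.Subset using (Subset; _∈_; _∩_; ∣_∣; Nonempty; Empty)
open import Data.Fin.Subset.Properties using (_∈?_; nonempty?)
open import Data.Nat.Base using (ℕ; zero; suc; _≤_; _<_; _⊓_; _⊔_; z≤n; NonZero)
open import Data.Nat.Properties using (+-0-commutativeMonoid; ≮⇒≥; m<1+n⇒m<n∨m≡n)
open import Data.Product.Base using (Σ; ∃; _×_; _,_; proj₁; proj₂)
open import Data.Sum.Base using (_⊎_; inj₁; inj₂)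
open import Data.Vec.Base using (Vec; []; _∷_; count; foldr₁; tabulate)
open import Data.Vec.Properties using (≡-dec)
open import Function.Definitions using (Injective)
open import Relation.Binary.PropositionalEquality
  using (_≡_; _≢_; refl; sym; trans; subst)
open import Relation.Nullary using (¬_; Dec; yes; no; ¬?; _×-dec_; _⊎-dec_; _→-dec_)
open import Relation.Unary using (Decidable)

minimum : ∀ {k} .{{_ : NonZero k}} → (Fin k → ℕ) → ℕ
minimum {suc k} f = foldr₁ _⊓_ (tabulate f)

maximum : ∀ {k} .{{_ : NonZero k}} → (Fin k → ℕ) → ℕ
maximum {suc k} f = foldr₁ _⊔_ (tabulate f)

-- The set E of hyperedges is given by an injective enumeration, so there are
-- no repeated hyperedges.
record Hypergraph : Set where
  field
    order          : ℕ
    size           : ℕ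
    {{order≢0}}    : NonZero order
    {{size≢0}}     : NonZero size
    edge           : Fin size → Subset order
    edge-nonempty  : ∀ i → Nonempty (edge i)
    edge-injective : Injective _≡_ _≡_ edge

open Hypergraph public

Loopless : Hypergraph → Set
Loopless H = ∀ i → ∣ edge H i ∣ ≢ 1

antirank : Hypergraph → ℕ
antirank H = minimum (λ i → ∣ edge H i ∣)

-- mult x y is the number of parallel edges joining x and y.
record LooplessMultigraph (n : ℕ) : Set where
  field
    mult      : Fin n → Fin n → ℕ
    mult-sym  : ∀ x y → mult x y ≡ mult y x
    mult-loop : ∀ x → mult x x ≡ 0

open LooplessMultigraph public

degree : ∀ {n} → LooplessMultigraph n → Fin n → ℕ
degree G x = sum +-0-commutativeMonoid (mult G x)

Δ : ∀ {n} .{{_ : NonZero n}} → LooplessMultigraph n → ℕ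
Δ G = maximum (degree G)

codegree : (H : Hypergraph) → Fin (order H) → Fin (order H) → ℕ
codegree H x y = count (λ e → (x ∈? e) ×-dec (y ∈? e)) (tabulate (edge H))

sectionMult : (H : Hypergraph) → Fin (order H) → Fin (order H) → ℕ
sectionMult H x y with x ≟ᶠ y
... | yes _ = 0
... | no  _ = codegree H x y

private
  count-swap : ∀ {n k} (x y : Fin n) (es : Vec (Subset n) k) →
    count (λ e → (x ∈? e) ×-dec (y ∈? e)) es ≡ count (λ e → (y ∈? e) ×-dec (x ∈? e)) es
  count-swap x y [] = refl
  count-swap x y (e ∷ es) with x ∈? e | y ∈? e
  ... | yes _ | yes _ rewrite count-swap x y es = refl
  ... | yes _ | no  _ = count-swap x y es
  ... | no  _ | yes _ = count-swap x y es
  ... | no  _ | no  _ = count-swap x y es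

  sectionMult-sym : ∀ H x y → sectionMult H x y ≡ sectionMult H y x
  sectionMult-sym H x y with x ≟ᶠ y | y ≟ᶠ x
  ... | yes _   | yes _   = refl
  ... | yes x≡y | no  y≢x = ⊥-elim (y≢x (sym x≡y))
  ... | no  x≢y | yes y≡x = ⊥-elim (x≢y (sym y≡x))
  ... | no  _   | no  _   = count-swap x y (tabulate (edge H))

  sectionMult-loop : ∀ H x → sectionMult H x x ≡ 0
  sectionMult-loop H x with x ≟ᶠ x
  ... | yes _   = refl
  ... | no  x≢x = ⊥-elim (x≢x refl)

[_]₂ : (H : Hypergraph) → LooplessMultigraph (order H)
[ H ]₂ = record
  { mult      = sectionMult H
  ; mult-sym  = sectionMult-sym H
  ; mult-loop = sectionMult-loop H
  }

IsColouring : (H : Hypergraph) {k : ℕ} → (Fin (size H) → Fin k) → Set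
IsColouring H c = ∀ i j → c i ≡ c j →
  Empty (edge H i ∩ edge H j) ⊎ edge H i ≡ edge H j

Colourable : Hypergraph → ℕ → Set
Colourable H k = Σ (Fin (size H) → Fin k) (IsColouring H)

IsLeast : (ℕ → Set) → ℕ → Set
IsLeast P k = P k × (∀ j → P j → k ≤ j)

-- The chromatic index exists: the identity colouring uses size H colours, and
-- colourability is decidable, colourings being coded by Fin (k ^ size H).
private
  isColouring? : ∀ H {k} (c : Fin (size H) → Fin k) → Dec (IsColouring H c)
  isColouring? H c = all? λ i → all? λ j → (c i ≟ᶠ c j) →-dec
    (¬? (nonempty? (edge H i ∩ edge H j)) ⊎-dec ≡-dec _≟ᵇ_ (edge H i) (edge H j))

  colourable? : ∀ H → Decidable (Colourable H)
  colourable? H k with any? (λ code → isColouring? H (finToFun {k} {size H} code))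
  ... | yes (code , col) = yes (finToFun code , col)
  ... | no  none = no λ (c , col) → none (funToFin c , λ i j eq →
          col i j (trans (sym (finToFun-funToFin c i))
                  (trans eq (finToFun-funToFin c j))))

  least-or-none : {P : ℕ → Set} → Decidable P → ∀ n →
    ∃ (IsLeast P) ⊎ (∀ j → j < n → ¬ P j)
  least-or-none P? zero = inj₂ λ _ ()
  least-or-none {P} P? (suc n) with least-or-none P? n
  ... | inj₁ found = inj₁ found
  ... | inj₂ none with P? n
  ...   | yes Pn = inj₁ (n , Pn , λ j Pj → ≮⇒≥ λ j<n → none j j<n Pj)
  ...   | no ¬Pn = inj₂ λ j j<1+n Pj → below j (m<1+n⇒m<n∨m≡n j<1+n) Pj
    where
    below : ∀ j → j < n ⊎ j ≡ n → ¬ P j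
    below j (inj₁ j<n) = none j j<n
    below j (inj₂ j≡n) Pj = ¬Pn (subst P j≡n Pj)

  least : {P : ℕ → Set} → Decidable P → ∀ n → P n → ∃ (IsLeast P)
  least P? n Pn with least-or-none P? n
  ... | inj₁ found = found
  ... | inj₂ none  = n , Pn , λ j Pj → ≮⇒≥ λ j<n → none j j<n Pj

  chromaticIndex-exists : ∀ H → ∃ (IsLeast (Colourable H))
  chromaticIndex-exists H = least (colourable? H) (size H)
    ((λ i → i) , λ { i .i refl → inj₂ refl })

q : Hypergraph → ℕ
q H = proj₁ (chromaticIndex-exists H)

q-isLeast : ∀ H → IsLeast (Colourable H) (q H)
q-isLeast H = proj₂ (chromaticIndex-exists H)

{-# OPTIONS --safe #-}
module Submission where

-- Let D = Δ([H]₂) and let k be the antirank. Double counting the degrees of the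
-- vertices of a hyperedge e gives Σ_f |e ∩ f| (|f| − 1) ≤ |e| D. Hence, within any set
-- S of hyperedges, e meets at most D others, provided those are at least as large as e;
-- the only exception has D + 1 = k² neighbours, with every inequality an equality:
-- e and its neighbours have size k, each neighbour lies in S and meets e in one point,
-- and every vertex of e lies on k + 1 hyperedges. So S contains either a hyperedge with
-- at most D neighbours in S, or only exceptional ones. In the latter case take
-- x ≠ y in e and f ≠ e through y: by linearity the k points of f cannot meet all the k + 1
-- hyperedges through x, so the intersection graph of S is (D + 1)-regular with an
-- induced path of length two. Brooks' theorem, proved after Zając by greedy colouring
-- along a maximal path, then yields a colouring with D + 1 colours.

open import Defs
open import Algebra.Properties.Semiring.Sum as SemiringSum using ()
open import Data.Bool.Base using (true; false; if_then_else_; _∧_)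
open import Data.Fin.Base using (Fin; zero; suc)
open import Data.Fin.Properties using (all?; any?; ¬∀⟶∃¬) renaming (_≟_ to _≟ᶠ_)
open import Data.Fin.Subset
  using (Subset; inside; outside; _∈_; _∉_; _∩_; _-_; ∣_∣; Nonempty; Empty; ⊤; ⁅_⁆)
open import Data.Fin.Subset.Properties
  using ( _∈?_; nonempty?; Empty-unique; ∣⊥∣≡0; ∣⊤∣≡n; ∈⊤; x∈p⇒∣p-x∣<∣p∣; x∈p∧x≢y⇒x∈p-y
        ; x∈p∩q⁺; x∈p∩q⁻; p⊂q⇒∣p∣<∣q∣; p─⊥≡p; p─q⊆p
        ; x∈⁅x⁆; x≢y⇒x∉⁅y⁆; ∣⁅x⁆∣≡1; ∩-idem)
open import Data.List.Base using (List; []; _∷_; _++_; _ʳ++_)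
open import Data.List.Membership.DecPropositional using () renaming (_∈?_ to list-∈?)
open import Data.List.Membership.Propositional using () renaming (_∈_ to _∈ˡ_; _∉_ to _∉ˡ_)
open import Data.List.Membership.Propositional.Properties using (∈-++⁺ˡ; ∈-++⁺ʳ; ∈-++⁻; ∈-∃++)
open import Data.List.Properties using (∷-injectiveʳ; ++-assoc)
open import Data.List.Relation.Unary.All as All using (All; []; _∷_)
open import Data.List.Relation.Unary.All.Properties using (¬Any⇒All¬) renaming (++⁻ˡ to All-++⁻ˡ)
open import Data.List.Relation.Unary.AllPairs using ([]; _∷_)
open import Data.List.Relation.Unary.Any as Any using (Any; here; there)
open import Data.List.Relation.Unary.Any.Properties using (reverseAcc⁺; reverseAcc⁻)
open import Data.List.Relation.Unary.Linked using (Linked; []; [-]; _∷_)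
open import Data.List.Relation.Unary.Unique.Propositional using (Unique)
open import Data.Nat.Base
  using (ℕ; zero; suc; _+_; _*_; _∸_; _^_; _≤_; _<_; _≥_; z≤n; s≤s; s≤s⁻¹; z<s; NonZero; >-nonZero)
open import Data.Nat.Properties
open import Data.Nat.Tactic.RingSolver using (solve-∀)
open import Data.Product.Base using (∃; ∃₂; _×_; _,_; proj₁; proj₂)
open import Data.Sum.Base using (_⊎_; inj₁; inj₂)
open import Data.Vec.Base using ([]; _∷_; there; tabulate; lookup; count)
open import Data.Vec.Functional using (updateAt)
open import Data.Vec.Functional.Properties using (updateAt-updates; updateAt-minimal)
open import Data.Vec.Properties using ([]=⇒lookup; lookup⇒[]=; lookup∘tabulate; lookup-zipWith)
open import Function.Base using (_∘_; const; case_of_)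
open import Relation.Binary.PropositionalEquality
open import Relation.Nullary using (¬_; Dec; does; yes; no; ¬?; _×-dec_; contradiction)
open import Relation.Nullary.Decidable using (dec-true)
open import Relation.Unary using (Pred; Decidable)

-- Finite subsets

⟦_⟧ : ∀ {n ℓ} {P : Pred (Fin n) ℓ} → Decidable P → Subset n
⟦ P? ⟧ = tabulate (does ∘ P?)

module _ {n ℓ} {P : Pred (Fin n) ℓ} (P? : Decidable P) where

  ∈⟦⟧⁺ : ∀ {i} → P i → i ∈ ⟦ P? ⟧
  ∈⟦⟧⁺ {i} Pi = lookup⇒[]= i _ (trans (lookup∘tabulate (does ∘ P?) i) (dec-true (P? i) Pi))

  ∈⟦⟧⁻ : ∀ {i} → i ∈ ⟦ P? ⟧ → P i
  ∈⟦⟧⁻ {i} i∈ with P? i | trans (sym (lookup∘tabulate (does ∘ P?) i)) ([]=⇒lookup i∈)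
  ... | yes Pi | _  = Pi
  ... | no _   | ()

x∉p-x : ∀ {n} (p : Subset n) x → x ∉ p - x
x∉p-x (_ ∷ p)       (suc x) (there x∈) = x∉p-x p x x∈
x∉p-x (inside ∷ p)  zero ()
x∉p-x (outside ∷ p) zero ()

∣p∣≤1+∣p-x∣ : ∀ {n} (p : Subset n) x → ∣ p ∣ ≤ suc ∣ p - x ∣
∣p∣≤1+∣p-x∣ (inside  ∷ p) zero    = s≤s (≤-reflexive (cong ∣_∣ (sym (p─⊥≡p p))))
∣p∣≤1+∣p-x∣ (outside ∷ p) zero    = m≤n⇒m≤1+n (≤-reflexive (cong ∣_∣ (sym (p─⊥≡p p))))
∣p∣≤1+∣p-x∣ (inside  ∷ p) (suc x) = s≤s (∣p∣≤1+∣p-x∣ p x)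
∣p∣≤1+∣p-x∣ (outside ∷ p) (suc x) = ∣p∣≤1+∣p-x∣ p x

0<∣p∣⇒Nonempty : ∀ {n} (p : Subset n) → 0 < ∣ p ∣ → Nonempty p
0<∣p∣⇒Nonempty {n} p 0<∣p∣ with nonempty? p
... | yes ne = ne
... | no  e  = contradiction (trans (cong ∣_∣ (Empty-unique e)) (∣⊥∣≡0 n)) (>⇒≢ 0<∣p∣)

x∈p⇒0<∣p∣ : ∀ {n} {p : Subset n} {x} → x ∈ p → 0 < ∣ p ∣
x∈p⇒0<∣p∣ x∈p = ≤-trans z<s (x∈p⇒∣p-x∣<∣p∣ x∈p)

x≢y⇒1<∣p∣ : ∀ {n} {p : Subset n} {x y} → x ∈ p → y ∈ p → x ≢ y → 1 < ∣ p ∣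
x≢y⇒1<∣p∣ x∈p y∈p x≢y =
  ≤-trans (s≤s (x∈p⇒0<∣p∣ (x∈p∧x≢y⇒x∈p-y x∈p x≢y))) (x∈p⇒∣p-x∣<∣p∣ y∈p)

1<∣p∣⇒∃≢ : ∀ {n} (p : Subset n) x → 1 < ∣ p ∣ → ∃ λ y → y ∈ p × y ≢ x
1<∣p∣⇒∃≢ p x 1<∣p∣ with 0<∣p∣⇒Nonempty (p - x) (s≤s⁻¹ (≤-trans 1<∣p∣ (∣p∣≤1+∣p-x∣ p x)))
... | y , y∈ = y , p─q⊆p p ⁅ x ⁆ y∈ , λ { refl → x∉p-x p x y∈ }

2<∣p∣⇒∃≢≢ : ∀ {n} (p : Subset n) x y → 2 < ∣ p ∣ → ∃ λ z → z ∈ p × z ≢ x × z ≢ y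
2<∣p∣⇒∃≢≢ p x y 2<∣p∣ with 1<∣p∣⇒∃≢ (p - x) y (s≤s⁻¹ (≤-trans 2<∣p∣ (∣p∣≤1+∣p-x∣ p x)))
... | z , z∈ , z≢y = z , p─q⊆p p ⁅ x ⁆ z∈ , (λ { refl → x∉p-x p x z∈ }) , z≢y

-- Match some `i` with a related `j`. If no other element of `p` is related to `j`, delete both and
-- recurse; the sizes stay strictly ordered. Stated for a relation, it serves both for colours
-- against vertices and for hyperedges against points.
pigeonhole-⊆ : ∀ {m n} {R : Fin m → Fin n → Set} → (∀ i j → Dec (R i j)) →
  (p : Subset m) (q : Subset n) → ∣ q ∣ < ∣ p ∣ →
  (∀ {i} → i ∈ p → ∃ λ j → j ∈ q × R i j) →
  ∃₂ λ i i′ → ∃ λ j → i ∈ p × i′ ∈ p × i ≢ i′ × j ∈ q × R i j × R i′ j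
pigeonhole-⊆ {R = R} R? p q = go ∣ q ∣ p q ≤-refl
  where
  go : ∀ n p q → ∣ q ∣ ≤ n → ∣ q ∣ < ∣ p ∣ → (∀ {i} → i ∈ p → ∃ λ j → j ∈ q × R i j) →
    ∃₂ λ i i′ → ∃ λ j → i ∈ p × i′ ∈ p × i ≢ i′ × j ∈ q × R i j × R i′ j
  go n p q ∣q∣≤n ∣q∣<∣p∣ f with 0<∣p∣⇒Nonempty p (≤-trans z<s ∣q∣<∣p∣)
  ... | i , i∈p with f i∈p
  ... | j , j∈q , Rij with any? (λ i′ → (i′ ∈? p) ×-dec ¬? (i ≟ᶠ i′) ×-dec R? i′ j)
  ... | yes (i′ , i′∈p , i≢i′ , Ri′j) = i , i′ , j , i∈p , i′∈p , i≢i′ , j∈q , Rij , Ri′j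
  go zero p q ∣q∣≤n _ f | i , _ | j , j∈q , _ | no _ =
    contradiction (≤-trans (x∈p⇒0<∣p∣ j∈q) ∣q∣≤n) λ ()
  go (suc n) p q ∣q∣≤n ∣q∣<∣p∣ f | i , i∈p | j , j∈q , Rij | no none =
    case go n (p - i) (q - j) (s≤s⁻¹ (≤-trans ∣q-j∣<∣q∣ ∣q∣≤n))
           (s≤s⁻¹ (≤-trans (s≤s ∣q-j∣<∣q∣) (≤-trans ∣q∣<∣p∣ (∣p∣≤1+∣p-x∣ p i)))) f′ of
      λ { (a , a′ , b , a∈ , a′∈ , a≢a′ , b∈ , Rs) →
          a , a′ , b , p─q⊆p p ⁅ i ⁆ a∈ , p─q⊆p p ⁅ i ⁆ a′∈ , a≢a′ , p─q⊆p q ⁅ j ⁆ b∈ , Rs }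
    where
    ∣q-j∣<∣q∣ = x∈p⇒∣p-x∣<∣p∣ j∈q
    f′ : ∀ {i′} → i′ ∈ p - i → ∃ λ j′ → j′ ∈ q - j × R i′ j′
    f′ {i′} i′∈ with f (p─q⊆p p ⁅ i ⁆ i′∈)
    ... | j′ , j′∈q , Ri′j′ = j′ , x∈p∧x≢y⇒x∈p-y j′∈q (λ { refl →
            none (i′ , p─q⊆p p ⁅ i ⁆ i′∈ , (λ { refl → x∉p-x p i i′∈ }) , Ri′j′) }) , Ri′j′

-- If every colour occurred on `p`, the pigeonhole principle applied to the colours would give a
-- vertex of `p` with two colours.
free-colour : ∀ {m d} (c : Fin m → Fin d) (p : Subset m) → ∣ p ∣ < d →
  ∃ λ a → ∀ i → i ∈ p → c i ≢ a
free-colour {m} {d} c p ∣p∣<d with all? (λ a → any? λ i → (i ∈? p) ×-dec (c i ≟ᶠ a))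
... | no ¬all with ¬∀⟶∃¬ _ _ (λ a → any? λ i → (i ∈? p) ×-dec (c i ≟ᶠ a)) ¬all
...   | a , ¬used = a , λ i i∈p ci≡a → ¬used (i , i∈p , ci≡a)
free-colour {m} {d} c p ∣p∣<d | yes all
  with pigeonhole-⊆ (λ a i → c i ≟ᶠ a) ⊤ p (subst (∣ p ∣ <_) (sym (∣⊤∣≡n d)) ∣p∣<d)
         (λ {a} _ → all a)
... | a , a′ , i , _ , _ , a≢a′ , _ , ci≡a , ci≡a′ = contradiction (trans (sym ci≡a) ci≡a′) a≢a′

-- Lists

module _ {A : Set} where

  ∈-ʳ++⁺ˡ : ∀ {x : A} {xs ys} → x ∈ˡ xs → x ∈ˡ xs ʳ++ ys
  ∈-ʳ++⁺ˡ x∈ = reverseAcc⁺ _ _ (inj₂ x∈)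

  ∈-ʳ++⁺ʳ : ∀ {x : A} xs {ys} → x ∈ˡ ys → x ∈ˡ xs ʳ++ ys
  ∈-ʳ++⁺ʳ xs x∈ = reverseAcc⁺ _ xs (inj₁ x∈)

  ∈-ʳ++⁻ : ∀ {x : A} xs {ys} → x ∈ˡ xs ʳ++ ys → x ∈ˡ xs ⊎ x ∈ˡ ys
  ∈-ʳ++⁻ xs x∈ with reverseAcc⁻ _ xs x∈
  ... | inj₁ x∈ys = inj₂ x∈ys
  ... | inj₂ x∈xs = inj₁ x∈xs

  Unique-++⇒disjoint : ∀ xs {ys} {x : A} → Unique (xs ++ ys) → x ∈ˡ xs → x ∉ˡ ys
  Unique-++⇒disjoint (x ∷ xs) (x∉ ∷ _) (here refl) x∈ys = All.lookup x∉ (∈-++⁺ʳ xs x∈ys) refl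
  Unique-++⇒disjoint (x ∷ xs) (_ ∷ u)  (there x∈)  x∈ys = Unique-++⇒disjoint xs u x∈ x∈ys

  Unique-++⁻ʳ : ∀ xs {ys : List A} → Unique (xs ++ ys) → Unique ys
  Unique-++⁻ʳ []       u       = u
  Unique-++⁻ʳ (_ ∷ xs) (_ ∷ u) = Unique-++⁻ʳ xs u

  Unique-++⁻ˡ : ∀ xs {ys : List A} → Unique (xs ++ ys) → Unique xs
  Unique-++⁻ˡ []       _        = []
  Unique-++⁻ˡ (_ ∷ xs) (x∉ ∷ u) = All-++⁻ˡ xs x∉ ∷ Unique-++⁻ˡ xs u

  last∈suffix : ∀ f {w : A} {ws} g {x} → f ++ w ∷ ws ≡ g ++ x ∷ [] → x ∈ˡ w ∷ ws
  last∈suffix []       g       eq = subst (_ ∈ˡ_) (sym eq) (∈-++⁺ʳ g (here refl))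
  last∈suffix (_ ∷ f)  (_ ∷ g) eq = last∈suffix f g (∷-injectiveʳ eq)
  last∈suffix (_ ∷ []) []      ()
  last∈suffix (_ ∷ _ ∷ _) []   ()

  module _ {P : A → Set} (P? : Decidable P) where

    split-last : ∀ {xs} → Any P xs →
      ∃₂ λ f x → ∃ λ b → xs ≡ f ++ x ∷ b × P x × All (¬_ ∘ P) b
    split-last {x ∷ xs} ∃P with Any.any? P? xs
    ... | yes ∃P′ with split-last ∃P′
    ...   | f , y , b , refl , Py , ¬Pb = x ∷ f , y , b , refl , Py , ¬Pb
    split-last {x ∷ xs} (here Px)   | no ¬∃P = [] , x , xs , refl , Px , ¬Any⇒All¬ xs ¬∃P
    split-last {x ∷ xs} (there ∃P′) | no ¬∃P = contradiction ∃P′ ¬∃P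

    -- Used on a cycle to find consecutive vertices `u`, `w` of which only the second has a
    -- neighbour off the cycle.
    boundary : ∀ {x xs} → ¬ P x → Any P xs →
      ∃₂ λ f u → ∃₂ λ w b → x ∷ xs ≡ f ++ u ∷ w ∷ b × ¬ P u × P w
    boundary {x} {y ∷ ys} ¬Px ∃P with P? y
    ... | yes Py = [] , x , y , ys , refl , ¬Px , Py
    boundary {x} {y ∷ ys} ¬Px (here Py)  | no ¬Py = contradiction Py ¬Py
    boundary {x} {y ∷ ys} ¬Px (there ∃P) | no ¬Py with boundary ¬Py ∃P
    ... | f , u , w , b , eq , ¬Pu , Pw = x ∷ f , u , w , b , cong (x ∷_) eq , ¬Pu , Pw

  module _ {R : A → A → Set} where

    Linked-++⁻ˡ : ∀ xs {ys} → Linked R (xs ++ ys) → Linked R xs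
    Linked-++⁻ˡ []           _       = []
    Linked-++⁻ˡ (_ ∷ [])     _       = [-]
    Linked-++⁻ˡ (_ ∷ y ∷ xs) (r ∷ l) = r ∷ Linked-++⁻ˡ (y ∷ xs) l

    Linked-++⁻ʳ : ∀ xs {ys} → Linked R (xs ++ ys) → Linked R ys
    Linked-++⁻ʳ []               l       = l
    Linked-++⁻ʳ (_ ∷ [])         [-]     = []
    Linked-++⁻ʳ (_ ∷ [])         (_ ∷ l) = l
    Linked-++⁻ʳ (_ ∷ y ∷ xs)     (_ ∷ l) = Linked-++⁻ʳ (y ∷ xs) l

-- Brooks' theorem

module Brooks {m d : ℕ} (N : Fin m → Subset m)
  (N-sym : ∀ {i j} → j ∈ N i → i ∈ N j) (N-irrefl : ∀ {i} → i ∉ N i) where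

  Adjacent : Fin m → Fin m → Set
  Adjacent i j = j ∈ N i

  Colouring : Set
  Colouring = Fin m → Fin (suc d)

  -- Colourings are total functions, so a partial colouring is one judged only on `P`; its values
  -- elsewhere are placeholders.
  Proper : Colouring → (Fin m → Set) → Set
  Proper c P = ∀ {i j} → P i → P j → Adjacent i j → c i ≢ c j

  infix 4 _∈ˡ?_
  _∈ˡ?_ : ∀ i (L : List (Fin m)) → Dec (i ∈ˡ L)
  _∈ˡ?_ = list-∈? _≟ᶠ_

  infixl 5 _∖_
  _∖_ : Subset m → List (Fin m) → Fin m → Set
  (S ∖ L) i = i ∈ S × i ∉ˡ L

  ∖? : ∀ S L → Decidable (S ∖ L)
  ∖? S L i = (i ∈? S) ×-dec ¬? (i ∈ˡ? L)

  Exit : Subset m → List (Fin m) → Fin m → Set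
  Exit S C u = ∃ λ y → Adjacent u y × (S ∖ C) y

  exit? : ∀ S C → Decidable (Exit S C)
  exit? S C u = any? λ y → (y ∈? N u) ×-dec ∖? S C y

  DegreeBounded : Subset m → Set
  DegreeBounded S = ∀ {v} → v ∈ S → ∣ N v ∩ S ∣ ≤ suc d

  -- With `d + 1` colours and degrees up to `d + 1`, plain greedy colouring may get stuck. The
  -- induced path `v₁ v₂ v₃` gives `v₂` two neighbours that may share a colour; the third neighbour
  -- `v₄` lets the colouring order end at `v₂` when the path spans `S`.
  Saturated : Subset m → Set
  Saturated S = DegreeBounded S ×
    ∃₂ λ v₁ v₂ → ∃₂ λ v₃ v₄ →
      (v₁ ∈ S × v₂ ∈ S × v₃ ∈ S × v₄ ∈ S) ×
      (Adjacent v₂ v₁ × Adjacent v₂ v₃ × Adjacent v₂ v₄) ×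
      v₁ ≢ v₃ × v₄ ≢ v₁ × v₄ ≢ v₃ × ¬ Adjacent v₁ v₃

  module _ (c : Colouring) (w : Fin m) (a : Fin (suc d)) where

    recolour : Colouring
    recolour = updateAt c w (const a)

    recolour-≡ : recolour w ≡ a
    recolour-≡ = updateAt-updates w c

    recolour-≢ : ∀ {i} → i ≢ w → recolour i ≡ c i
    recolour-≢ {i} i≢w = updateAt-minimal i w c i≢w

    recolour-proper : ∀ {P Q : Fin m → Set} → Proper c P →
      (∀ {i} → P i → Adjacent w i → c i ≢ a) →
      (∀ {i} → Q i → i ≢ w → P i) → Proper recolour Q
    recolour-proper proper free Q⇒P {i} {j} Qi Qj i~j with i ≟ᶠ w | j ≟ᶠ w
    ... | yes refl | yes refl = contradiction i~j N-irrefl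
    ... | yes refl | no j≢w = λ eq →
      free (Q⇒P Qj j≢w) i~j (trans (sym (recolour-≢ j≢w)) (trans (sym eq) recolour-≡))
    ... | no i≢w | yes refl = λ eq →
      free (Q⇒P Qi i≢w) (N-sym i~j) (trans (sym (recolour-≢ i≢w)) (trans eq recolour-≡))
    ... | no i≢w | no j≢w = λ eq → proper (Q⇒P Qi i≢w) (Q⇒P Qj j≢w) i~j
      (trans (sym (recolour-≢ i≢w)) (trans eq (recolour-≢ j≢w)))

  -- Colouring a chain from left to right, each vertex but z still has an uncoloured neighbour.
  data Chain (z : Fin m) : List (Fin m) → Set where
    end  : Chain z (z ∷ [])
    step : ∀ {w x L} → x ∈ˡ L → Adjacent w x → Chain z L → Chain z (w ∷ L)

  -- Reversing a path that leads away from `L` puts each of its vertices before the one nearer to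
  -- `L`, which is then still uncoloured.
  chain-ʳ++ : ∀ {z x L} back → x ∈ˡ L → Linked Adjacent (x ∷ back) → Chain z L →
    Chain z (back ʳ++ L)
  chain-ʳ++ []         x∈L _         ch = ch
  chain-ʳ++ (y ∷ back) x∈L (x~y ∷ l) ch = chain-ʳ++ back (here refl) l (step x∈L (N-sym x~y) ch)

  chain-++ : ∀ {z x b L} front → Linked Adjacent (front ++ x ∷ b) → Chain z (x ∷ L) →
    Chain z (front ++ x ∷ L)
  chain-++ []              _         ch = ch
  chain-++ (u ∷ [])        (u~x ∷ l) ch = step (here refl) u~x ch
  chain-++ (u ∷ v ∷ front) (u~v ∷ l) ch = step (here refl) u~v (chain-++ (v ∷ front) l ch)

  module _ {S : Subset m} (deg≤ : DegreeBounded S) where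

    -- When a vertex other than `z` is coloured, one neighbour in `S` is still waiting, so at most
    -- `d` colours are blocked. At `z` all neighbours may be coloured, but `a` and `b` block the
    -- same colour, so again at most `d` are blocked.
    greedy : ∀ {z a b L} c → Chain z L → (∀ {i} → i ∈ˡ L → i ∈ S) → Proper c (S ∖ L) →
      (S ∖ L) a → (S ∖ L) b → a ≢ b → Adjacent z a → Adjacent z b → c a ≡ c b →
      ∃ λ c′ → Proper c′ (_∈ S)
    greedy {z} {a} {b} c end L⊆S proper Sa Sb a≢b z~a z~b ca≡cb
      with free-colour c (N z ∩ S - b) (≤-trans (x∈p⇒∣p-x∣<∣p∣ (x∈p∩q⁺ (z~b , proj₁ Sb)))
                                               (deg≤ (L⊆S (here refl))))
    ... | k , free = recolour c z k , recolour-proper c z k proper free′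
            λ i∈S i≢z → i∈S , λ { (here refl) → i≢z refl }
      where
      free′ : ∀ {i} → (S ∖ (z ∷ [])) i → Adjacent z i → c i ≢ k
      free′ {i} (i∈S , _) z~i ci≡k with i ≟ᶠ b
      ... | yes refl = free a (x∈p∧x≢y⇒x∈p-y (x∈p∩q⁺ (z~a , proj₁ Sa)) a≢b) (trans ca≡cb ci≡k)
      ... | no  i≢b  = free i (x∈p∧x≢y⇒x∈p-y (x∈p∩q⁺ (z~i , i∈S)) i≢b) ci≡k
    greedy {z} {a} {b} c (step {w} {x} {L} x∈L w~x ch) L⊆S proper Sa Sb a≢b z~a z~b ca≡cb
      with free-colour c (N w ∩ S - x)
             (≤-trans (x∈p⇒∣p-x∣<∣p∣ (x∈p∩q⁺ (w~x , L⊆S (there x∈L)))) (deg≤ (L⊆S (here refl))))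
    ... | k , free = greedy (recolour c w k) ch (L⊆S ∘ there)
            (recolour-proper c w k proper
              (λ (i∈S , i∉) w~i → free _ (x∈p∧x≢y⇒x∈p-y (x∈p∩q⁺ (w~i , i∈S))
                                            λ { refl → i∉ (there x∈L) }))
              (λ (i∈S , i∉L) i≢w → i∈S , λ { (here refl) → i≢w refl ; (there i∈L) → i∉L i∈L }))
            (weaken Sa) (weaken Sb) a≢b z~a z~b
            (trans (recolour-≢ c w k (≢w Sa)) (trans ca≡cb (sym (recolour-≢ c w k (≢w Sb)))))
      where
      weaken : ∀ {i} → (S ∖ (w ∷ L)) i → (S ∖ L) i
      weaken (i∈S , i∉) = i∈S , i∉ ∘ there
      ≢w : ∀ {i} → (S ∖ (w ∷ L)) i → i ≢ w
      ≢w (_ , i∉) refl = i∉ (here refl)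

  record Path (S : Subset m) (L : List (Fin m)) : Set where
    field
      linked : Linked Adjacent L
      unique : Unique L
      inS    : ∀ {i} → i ∈ˡ L → i ∈ S

  Maximal : Subset m → Fin m → List (Fin m) → Set
  Maximal S h t = ∀ {x} → x ∈ S → Adjacent h x → x ∈ˡ h ∷ t

  -- The path grows at its head only, so that `v₃ v₂ v₁` remains its far end. Growth stops because
  -- every new head uses up a vertex of `S` off the path.
  maximal-path : ∀ {S h t} → Path S (h ∷ t) →
    ∃₂ λ h′ t′ → ∃ λ ext → h′ ∷ t′ ≡ ext ++ h ∷ t × Path S (h′ ∷ t′) × Maximal S h′ t′
  maximal-path {S} {h} {t} path = go (suc ∣ ⟦ ∖? S (h ∷ t) ⟧ ∣) path ≤-refl
    where
    go : ∀ n {h t} → Path S (h ∷ t) → ∣ ⟦ ∖? S (h ∷ t) ⟧ ∣ < n →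
      ∃₂ λ h′ t′ → ∃ λ ext → h′ ∷ t′ ≡ ext ++ h ∷ t × Path S (h′ ∷ t′) × Maximal S h′ t′
    go (suc n) {h} {t} path <n with any? (λ x → (x ∈? N h) ×-dec ∖? S (h ∷ t) x)
    ... | no none = h , t , [] , refl , path , λ {x} x∈S h~x → case x ∈ˡ? (h ∷ t) of
            λ { (yes x∈) → x∈ ; (no x∉) → contradiction (x , h~x , x∈S , x∉) none }
    ... | yes (x , h~x , x∈S , x∉)
      with go n {x} {h ∷ t} path′ (≤-trans (p⊂q⇒∣p∣<∣q∣ smaller) (s≤s⁻¹ <n))
      where
      open Path path
      path′ : Path S (x ∷ h ∷ t)
      path′ = record
        { linked = N-sym h~x ∷ linked
        ; unique = ¬Any⇒All¬ _ x∉ ∷ unique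
        ; inS    = λ { (here refl) → x∈S ; (there i∈) → inS i∈ }
        }
      smaller = (λ {i} i∈ → case ∈⟦⟧⁻ (∖? S (x ∷ h ∷ t)) i∈ of
                  λ (i∈S , i∉) → ∈⟦⟧⁺ (∖? S (h ∷ t)) (i∈S , i∉ ∘ there))
              , x , ∈⟦⟧⁺ (∖? S (h ∷ t)) (x∈S , x∉)
              , λ x∈ → proj₂ (∈⟦⟧⁻ (∖? S (x ∷ h ∷ t)) x∈) (here refl)
    ... | h′ , t′ , ext , eq , res =
      h′ , t′ , ext ++ x ∷ [] , trans eq (sym (++-assoc ext (x ∷ []) _)) , res

  ColourableOn : Subset m → Set
  ColourableOn S = ∃ λ c → Proper c (_∈ S)

  -- v₁ and v₃ receive the same colour and v₂ comes last; the path from v₄ to its end is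
  -- coloured backwards, after the part between v₃ and v₄.
  hamiltonian : ∀ {S} → DegreeBounded S → ∀ {v₁ v₂ v₃ v₄} ext → Path S (ext ++ v₃ ∷ v₂ ∷ v₁ ∷ []) →
    (∀ {i} → i ∈ S → i ∈ˡ ext ++ v₃ ∷ v₂ ∷ v₁ ∷ []) →
    v₄ ∈ S → Adjacent v₂ v₄ → v₁ ≢ v₃ → v₄ ≢ v₁ → v₄ ≢ v₃ → ¬ Adjacent v₁ v₃ → ColourableOn S
  hamiltonian {S} deg≤ {v₁} {v₂} {v₃} {v₄} ext path covers v₄∈S v₂~v₄ v₁≢v₃ v₄≢v₁ v₄≢v₃ v₁≁v₃
    with ∈-∃++ v₄∈ext
    where
    v₄∈ext : v₄ ∈ˡ ext
    v₄∈ext with ∈-++⁻ ext (covers v₄∈S)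
    ... | inj₁ v₄∈ = v₄∈
    ... | inj₂ (here refl) = contradiction refl v₄≢v₃
    ... | inj₂ (there (here refl)) = contradiction v₂~v₄ N-irrefl
    ... | inj₂ (there (there (here refl))) = contradiction refl v₄≢v₁
  ... | front , back , refl =
    -- The constant colouring is a legitimate start: only `v₁` and `v₃` count as coloured, and they
    -- are not adjacent.
    greedy deg≤ (const zero) chain (inS ∘ L⊆path) proper
      (inS (∈-++⁺ʳ ext (there (there (here refl)))) , v₁∉L) (inS (∈-++⁺ʳ ext (here refl)) , v₃∉L)
      v₁≢v₃ v₂~v₁ (N-sym v₃~v₂) refl
    where
    open Path path
    L = back ʳ++ (front ++ v₄ ∷ v₂ ∷ [])
    tail-linked : Linked Adjacent (v₃ ∷ v₂ ∷ v₁ ∷ [])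
    tail-linked = Linked-++⁻ʳ (front ++ v₄ ∷ back) linked
    v₃~v₂ : Adjacent v₃ v₂
    v₃~v₂ = case tail-linked of λ { (r ∷ _) → r }
    v₂~v₁ : Adjacent v₂ v₁
    v₂~v₁ = case tail-linked of λ { (_ ∷ r ∷ _) → r }
    ext-linked : Linked Adjacent (front ++ v₄ ∷ back)
    ext-linked = Linked-++⁻ˡ (front ++ v₄ ∷ back) linked
    chain : Chain v₂ L
    chain = chain-ʳ++ back (∈-++⁺ʳ front (here refl)) (Linked-++⁻ʳ front ext-linked)
              (chain-++ front ext-linked (step (here refl) (N-sym v₂~v₄) end))
    L⊆ : ∀ {i} → i ∈ˡ L → i ∈ˡ front ++ v₄ ∷ back ⊎ i ≡ v₂
    L⊆ i∈L with ∈-ʳ++⁻ back i∈L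
    ... | inj₁ i∈back = inj₁ (∈-++⁺ʳ front (there i∈back))
    ... | inj₂ i∈ with ∈-++⁻ front i∈
    ...   | inj₁ i∈front = inj₁ (∈-++⁺ˡ i∈front)
    ...   | inj₂ (here i≡v₄) = inj₁ (∈-++⁺ʳ front (here i≡v₄))
    ...   | inj₂ (there (here i≡v₂)) = inj₂ i≡v₂
    L⊆path : ∀ {i} → i ∈ˡ L → i ∈ˡ (front ++ v₄ ∷ back) ++ v₃ ∷ v₂ ∷ v₁ ∷ []
    L⊆path i∈L with L⊆ i∈L
    ... | inj₁ i∈ = ∈-++⁺ˡ i∈
    ... | inj₂ i≡v₂ = ∈-++⁺ʳ (front ++ v₄ ∷ back) (there (here i≡v₂))
    ext⊆L : ∀ {i} → i ∈ˡ front ++ v₄ ∷ back → i ∈ˡ L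
    ext⊆L i∈ with ∈-++⁻ front i∈
    ... | inj₁ i∈front = ∈-ʳ++⁺ʳ back (∈-++⁺ˡ i∈front)
    ... | inj₂ (here i≡v₄) = ∈-ʳ++⁺ʳ back (∈-++⁺ʳ front (here i≡v₄))
    ... | inj₂ (there i∈back) = ∈-ʳ++⁺ˡ i∈back
    v₁∉L : v₁ ∉ˡ L
    v₁∉L v₁∈L with L⊆ v₁∈L
    ... | inj₁ v₁∈ = Unique-++⇒disjoint (front ++ v₄ ∷ back) unique v₁∈ (there (there (here refl)))
    ... | inj₂ refl = N-irrefl v₂~v₁
    v₃∉L : v₃ ∉ˡ L
    v₃∉L v₃∈L with L⊆ v₃∈L
    ... | inj₁ v₃∈ = Unique-++⇒disjoint (front ++ v₄ ∷ back) unique v₃∈ (here refl)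
    ... | inj₂ refl = N-irrefl v₃~v₂
    only : ∀ {i} → (S ∖ L) i → i ≡ v₁ ⊎ i ≡ v₃
    only (i∈S , i∉L) with ∈-++⁻ (front ++ v₄ ∷ back) (covers i∈S)
    ... | inj₁ i∈ = contradiction (ext⊆L i∈) i∉L
    ... | inj₂ (here i≡v₃) = inj₂ i≡v₃
    ... | inj₂ (there (here i≡v₂)) =
            contradiction (∈-ʳ++⁺ʳ back (∈-++⁺ʳ front (there (here i≡v₂)))) i∉L
    ... | inj₂ (there (there (here i≡v₁))) = inj₁ i≡v₁
    proper : Proper (const zero) (S ∖ L)
    proper i∈ j∈ i~j _ with only i∈ | only j∈
    ... | inj₁ refl | inj₁ refl = N-irrefl i~j
    ... | inj₁ refl | inj₂ refl = v₁≁v₃ i~j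
    ... | inj₂ refl | inj₁ refl = v₁≁v₃ (N-sym i~j)
    ... | inj₂ refl | inj₂ refl = N-irrefl i~j

  -- The list `C` is read cyclically, closed up by the edge between `h` and `x`. With `front` empty
  -- it is a single edge, which does no harm.
  module _ {S h x} front (path : Path S (h ∷ front ++ x ∷ [])) (h~x : Adjacent h x) where

    private
      open Path path
      C : List (Fin m)
      C = h ∷ front ++ x ∷ []

    -- The neighbours u, w on the cycle are such that u has no exit and w has one, y: giving u
    -- the colour of y is harmless, and going round the cycle from u to w then ends at a
    -- vertex with two neighbours of the same colour.
    cycle-with-exit : DegreeBounded S → ∀ c → Proper c (S ∖ C) → ¬ Exit S C h → Any (Exit S C) (front ++ x ∷ []) → ColourableOn S
    cycle-with-exit deg≤ c proper ¬exit-h exits with boundary (exit? S C) ¬exit-h exits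
    ... | pre , u , w , post , eq , ¬exit-u , (y , w~y , y∈S , y∉C) =
      greedy deg≤ c₁ chain (inS ∘ L⊆C) proper₁
        (inS u∈C , u∉L) (y∈S , y∉C ∘ L⊆C) u≢y (N-sym u~w) w~y
        (trans (recolour-≡ c u (c y)) (sym (recolour-≢ c u (c y) (u≢y ∘ sym))))
      where
      -- From the predecessor of `u` down to `h`, across the closing edge to `x`, then down to `w`.
      -- If `pre` is empty, `u` is `h` and the order starts at `x`.
      L = pre ʳ++ (post ʳ++ (w ∷ []))
      c₁ = recolour c u (c y)
      linked′ : Linked Adjacent (pre ++ u ∷ w ∷ post)
      linked′ = subst (Linked Adjacent) eq linked
      unique′ : Unique (pre ++ u ∷ w ∷ post)
      unique′ = subst Unique eq unique
      to : ∀ {i} → i ∈ˡ pre ++ u ∷ w ∷ post → i ∈ˡ C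
      to = subst (_ ∈ˡ_) (sym eq)
      u∈C : u ∈ˡ C
      u∈C = to (∈-++⁺ʳ pre (here refl))
      u~w : Adjacent u w
      u~w = case Linked-++⁻ʳ pre linked′ of λ { (r ∷ _) → r }
      w-post : Linked Adjacent (w ∷ post)
      w-post = case Linked-++⁻ʳ pre linked′ of λ { (_ ∷ l) → l }
      u≢y : u ≢ y
      u≢y refl = y∉C u∈C
      x∈ : x ∈ˡ w ∷ post
      x∈ = last∈suffix (pre ++ u ∷ []) (h ∷ front)
             (trans (++-assoc pre (u ∷ []) _) (sym eq))
      x∈′ : x ∈ˡ post ʳ++ (w ∷ [])
      x∈′ with x∈
      ... | here x≡w     = ∈-ʳ++⁺ʳ post (here x≡w)
      ... | there x∈post = ∈-ʳ++⁺ˡ x∈post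
      x-pre : Linked Adjacent (x ∷ pre)
      x-pre = Linked-++⁻ˡ (x ∷ pre) (subst (λ l → Linked Adjacent (x ∷ l)) eq (N-sym h~x ∷ linked))
      chain : Chain w L
      chain = chain-ʳ++ pre x∈′ x-pre (chain-ʳ++ post (here refl) w-post end)
      L⊆ : ∀ {i} → i ∈ˡ L → i ∈ˡ pre ⊎ i ∈ˡ w ∷ post
      L⊆ i∈L with ∈-ʳ++⁻ pre i∈L
      ... | inj₁ i∈pre = inj₁ i∈pre
      ... | inj₂ i∈ with ∈-ʳ++⁻ post i∈
      ...   | inj₁ i∈post = inj₂ (there i∈post)
      ...   | inj₂ (here i≡w) = inj₂ (here i≡w)
      L⊆C : ∀ {i} → i ∈ˡ L → i ∈ˡ C
      L⊆C i∈L with L⊆ i∈L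
      ... | inj₁ i∈pre = to (∈-++⁺ˡ i∈pre)
      ... | inj₂ i∈ = to (∈-++⁺ʳ pre (there i∈))
      u∉L : u ∉ˡ L
      u∉L u∈L with L⊆ u∈L | Unique-++⁻ʳ pre unique′
      ... | inj₁ u∈pre | _      = Unique-++⇒disjoint pre unique′ u∈pre (here refl)
      ... | inj₂ u∈    | u≢ ∷ _ = All.lookup u≢ u∈ refl
      outside-C : ∀ {i} → (S ∖ L) i → i ≢ u → (S ∖ C) i
      outside-C (i∈S , i∉L) i≢u = i∈S , λ i∈C → case ∈-++⁻ pre (subst (_ ∈ˡ_) eq i∈C) of
        λ { (inj₁ i∈pre) → i∉L (∈-ʳ++⁺ˡ i∈pre)
          ; (inj₂ (here i≡u)) → i≢u i≡u
          ; (inj₂ (there (here i≡w))) → i∉L (∈-ʳ++⁺ʳ pre (∈-ʳ++⁺ʳ post (here i≡w)))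
          ; (inj₂ (there (there i∈post))) → i∉L (∈-ʳ++⁺ʳ pre (∈-ʳ++⁺ˡ i∈post)) }
      proper₁ : Proper c₁ (S ∖ L)
      proper₁ = recolour-proper c u (c y) proper
        (λ {i} i∈ u~i _ → ¬exit-u (i , u~i , i∈)) outside-C

    -- No edge joins the cycle to the rest of `S`, so any two colourings of the parts can be glued.
    cycle-without-exit : ∀ c c′ → Proper c (S ∖ C) → Proper c′ (_∈ˡ C) →
      (∀ {i} → i ∈ˡ C → ¬ Exit S C i) → ColourableOn S
    cycle-without-exit c c′ proper proper′ ¬exit = c″ , proper″
      where
      c″ : Colouring
      c″ i with i ∈ˡ? C
      ... | yes _ = c′ i
      ... | no  _ = c i
      proper″ : Proper c″ (_∈ S)
      proper″ {i} {j} i∈S j∈S i~j with i ∈ˡ? C | j ∈ˡ? C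
      ... | yes i∈C | yes j∈C = proper′ i∈C j∈C i~j
      ... | yes i∈C | no j∉C  = contradiction (j , i~j , j∈S , j∉C) (¬exit i∈C)
      ... | no i∉C  | yes j∈C = contradiction (i , N-sym i~j , i∈S , i∉C) (¬exit j∈C)
      ... | no i∉C  | no j∉C  = proper (i∈S , i∉C) (j∈S , j∉C) i~j

  -- Induction on `∣ S ∣`, hence a hypothesis on all subsets. A vertex with at most `d` neighbours
  -- is coloured last. Otherwise a maximal path continuing the induced one either spans `S` or
  -- yields a cycle `C` through its head. The rest of `S` is coloured by induction; then `C` is
  -- coloured by going round it if it has an exit, and by induction if not.
  brooks : (∀ S → Nonempty S → (∃ λ v → v ∈ S × ∣ N v ∩ S ∣ < suc d) ⊎ Saturated S) →
    ∀ S → ColourableOn S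
  brooks reduce S = go (suc ∣ S ∣) S ≤-refl
    where
    go : ∀ n S → ∣ S ∣ < n → ColourableOn S
    go (suc n) S <n with nonempty? S
    ... | no empty = const zero , λ i∈S → contradiction (_ , i∈S) empty
    ... | yes ne with reduce S ne
    ...   | inj₁ (v , v∈S , deg<)
      with go n (S - v) (≤-trans (x∈p⇒∣p-x∣<∣p∣ v∈S) (s≤s⁻¹ <n))
    ...     | c , proper with free-colour c (N v ∩ S) deg<
    ...       | a , free = recolour c v a , recolour-proper c v a proper
                  (λ i∈ v~i → free _ (x∈p∩q⁺ (v~i , p─q⊆p S ⁅ v ⁆ i∈))) x∈p∧x≢y⇒x∈p-y
    go (suc n) S <n | yes ne | inj₂
      (deg≤ , v₁ , v₂ , v₃ , v₄ , (v₁∈ , v₂∈ , v₃∈ , v₄∈) , (v₂~v₁ , v₂~v₃ , v₂~v₄) ,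
        v₁≢v₃ , v₄≢v₁ , v₄≢v₃ , v₁≁v₃)
      with maximal-path start
      where
      start : Path S (v₃ ∷ v₂ ∷ v₁ ∷ [])
      start = record
        { linked = N-sym v₂~v₃ ∷ v₂~v₁ ∷ [-]
        ; unique = ((λ { refl → N-irrefl v₂~v₃ }) ∷ v₁≢v₃ ∘ sym ∷ [])
                 ∷ ((λ { refl → N-irrefl v₂~v₁ }) ∷ []) ∷ [] ∷ []
        ; inS    = λ { (here refl) → v₃∈ ; (there (here refl)) → v₂∈
                     ; (there (there (here refl))) → v₁∈ }
        }
    ... | h , t , ext , eq , path , maximal with any? (∖? S (h ∷ t))
    ...   | no covered = hamiltonian deg≤ ext (subst (Path S) eq path)
              (λ {i} i∈S → subst (i ∈ˡ_) eq (case i ∈ˡ? (h ∷ t) of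
                λ { (yes i∈) → i∈ ; (no i∉) → contradiction (i , i∈S , i∉) covered }))
              v₄∈ v₂~v₄ v₁≢v₃ v₄≢v₁ v₄≢v₃ v₁≁v₃
    -- With `x` the last neighbour of the head on the path, maximality puts all neighbours of `h` in
    -- `S` on the cycle, so `h` has no exit.
    ...   | yes (o , o∈S , o∉) with split-last (_∈? N h) (head-adjacent ext eq (Path.linked path))
      where
      head-adjacent : ∀ ext {v₃ v₂ v₁ h t} → h ∷ t ≡ ext ++ v₃ ∷ v₂ ∷ v₁ ∷ [] →
        Linked Adjacent (h ∷ t) → Any (_∈ N h) t
      head-adjacent []           refl (h~x ∷ _) = here h~x
      head-adjacent (_ ∷ [])     refl (h~x ∷ _) = here h~x
      head-adjacent (_ ∷ _ ∷ _)  refl (h~x ∷ _) = here h~x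
    ...     | front , x , back , refl , h~x , ¬back = on-cycle
      where
      C : List (Fin m)
      C = h ∷ front ++ x ∷ []
      C⊆path : ∀ {i} → i ∈ˡ C → i ∈ˡ h ∷ front ++ x ∷ back
      C⊆path (here i≡h) = here i≡h
      C⊆path (there i∈) with ∈-++⁻ front i∈
      ... | inj₁ i∈front = there (∈-++⁺ˡ i∈front)
      ... | inj₂ (here i≡x) = there (∈-++⁺ʳ front (here i≡x))
      split : C ++ back ≡ h ∷ front ++ x ∷ back
      split = cong (h ∷_) (++-assoc front (x ∷ []) back)
      cycle : Path S C
      cycle = record
        { linked = Linked-++⁻ˡ C (subst (Linked Adjacent) (sym split) (Path.linked path))
        ; unique = Unique-++⁻ˡ C (subst Unique (sym split) (Path.unique path))
        ; inS    = Path.inS path ∘ C⊆path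
        }
      ¬exit-h : ¬ Exit S C h
      ¬exit-h (y , h~y , y∈S , y∉C) with maximal y∈S h~y
      ... | here refl = N-irrefl h~y
      ... | there y∈ with ∈-++⁻ front y∈
      ...   | inj₁ y∈front = y∉C (there (∈-++⁺ˡ y∈front))
      ...   | inj₂ (here y≡x) = y∉C (there (∈-++⁺ʳ front (here y≡x)))
      ...   | inj₂ (there y∈back) = All.lookup ¬back y∈back h~y
      S∖C<S : ∣ ⟦ ∖? S C ⟧ ∣ < ∣ S ∣
      S∖C<S = p⊂q⇒∣p∣<∣q∣ ((λ i∈ → proj₁ (∈⟦⟧⁻ (∖? S C) i∈)) , h , Path.inS path (here refl)
                , λ h∈ → proj₂ (∈⟦⟧⁻ (∖? S C) h∈) (here refl))
      -- The vertex `o` missed by the path makes the cycle a proper part of `S`, so that induction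
      -- applies to it.
      C<S : ∣ ⟦ (_∈ˡ? C) ⟧ ∣ < ∣ S ∣
      C<S = p⊂q⇒∣p∣<∣q∣ ((λ i∈ → Path.inS cycle (∈⟦⟧⁻ (_∈ˡ? C) i∈)) , o , o∈S
              , λ o∈ → o∉ (C⊆path (∈⟦⟧⁻ (_∈ˡ? C) o∈)))
      on-cycle : ColourableOn S
      on-cycle with go n ⟦ ∖? S C ⟧ (≤-trans S∖C<S (s≤s⁻¹ <n))
      ... | c , proper
        with Any.any? (exit? S C) (front ++ x ∷ [])
      ...   | yes exits = cycle-with-exit front cycle h~x deg≤ c
                (λ i∈ j∈ → proper (∈⟦⟧⁺ (∖? S C) i∈) (∈⟦⟧⁺ (∖? S C) j∈)) ¬exit-h exits
      ...   | no ¬exits with go n ⟦ (_∈ˡ? C) ⟧ (≤-trans C<S (s≤s⁻¹ <n))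
      ...     | c′ , proper′ = cycle-without-exit front cycle h~x c c′
                (λ i∈ j∈ → proper (∈⟦⟧⁺ (∖? S C) i∈) (∈⟦⟧⁺ (∖? S C) j∈))
                (λ i∈ j∈ → proper′ (∈⟦⟧⁺ (_∈ˡ? C) i∈) (∈⟦⟧⁺ (_∈ˡ? C) j∈))
                λ { (here refl) → ¬exit-h ; (there i∈) → All.lookup (¬Any⇒All¬ _ ¬exits) i∈ }

-- Sums and double counting

open SemiringSum +-*-semiring using (sum; sum-cong-≗; ∑-comm; ∑-distrib-+; *-distribˡ-sum; *-distribʳ-sum)

sum-mono-≤ : ∀ {n} {f g : Fin n → ℕ} → (∀ i → f i ≤ g i) → sum f ≤ sum g
sum-mono-≤ {zero}  f≤g = z≤n
sum-mono-≤ {suc n} f≤g = +-mono-≤ (f≤g zero) (sum-mono-≤ (f≤g ∘ suc))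

-- The equality case of a termwise comparison; it is what turns an extremal count into structure.
sum-≤-antisym : ∀ {n} {f g : Fin n → ℕ} → (∀ i → f i ≤ g i) → sum g ≤ sum f → ∀ i → f i ≡ g i
sum-≤-antisym {suc n} {f} {g} f≤g Σg≤Σf zero = ≤-antisym (f≤g zero)
  (+-cancelʳ-≤ (sum (g ∘ suc)) _ _
    (≤-trans Σg≤Σf (+-monoʳ-≤ (f zero) (sum-mono-≤ (f≤g ∘ suc)))))
sum-≤-antisym {suc n} {f} {g} f≤g Σg≤Σf (suc i) = sum-≤-antisym (f≤g ∘ suc)
  (+-cancelˡ-≤ (g zero) _ _ (≤-trans Σg≤Σf (+-monoˡ-≤ (sum (f ∘ suc)) (f≤g zero)))) i

χ : ∀ {n} → Subset n → Fin n → ℕ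
χ p i = if lookup p i then 1 else 0

χ-∈ : ∀ {n} {p : Subset n} {i} → i ∈ p → χ p i ≡ 1
χ-∈ i∈p = cong (if_then 1 else 0) ([]=⇒lookup i∈p)

χ-∉ : ∀ {n} {p : Subset n} {i} → i ∉ p → χ p i ≡ 0
χ-∉ {p = p} {i} i∉p with lookup p i in eq
... | true  = contradiction (lookup⇒[]= i p eq) i∉p
... | false = refl

sum-χ : ∀ {n} (p : Subset n) → sum (χ p) ≡ ∣ p ∣
sum-χ []            = refl
sum-χ (inside  ∷ p) = cong suc (sum-χ p)
sum-χ (outside ∷ p) = sum-χ p

χ-∩ : ∀ {n} (p q : Subset n) i → χ (p ∩ q) i ≡ χ p i * χ q i
χ-∩ p q i rewrite lookup-zipWith _∧_ i p q with lookup p i | lookup q i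
... | true  | true  = refl
... | true  | false = refl
... | false | _     = refl

sum-χ* : ∀ {n} (p q : Subset n) → sum (λ i → χ p i * χ q i) ≡ ∣ p ∩ q ∣
sum-χ* p q = trans (sum-cong-≗ (λ i → sym (χ-∩ p q i))) (sum-χ (p ∩ q))

-- Written with indicators, codegrees can be summed over vertices by exchanging the order of
-- summation.
count-∈∈ : ∀ {n k} x y (es : Fin k → Subset n) →
  count (λ e → (x ∈? e) ×-dec (y ∈? e)) (tabulate es) ≡ sum (λ i → χ (es i) x * χ (es i) y)
count-∈∈ {k = zero}  x y es = refl
count-∈∈ {k = suc k} x y es with x ∈? es zero | y ∈? es zero
... | yes x∈ | yes y∈ rewrite χ-∈ x∈ | χ-∈ y∈ = cong suc (count-∈∈ x y (es ∘ suc))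
... | yes x∈ | no  y∉ rewrite χ-∈ x∈ | χ-∉ y∉ = count-∈∈ x y (es ∘ suc)
... | no  x∉ | yes _  rewrite χ-∉ x∉ = count-∈∈ x y (es ∘ suc)
... | no  x∉ | no  _  rewrite χ-∉ x∉ = count-∈∈ x y (es ∘ suc)

f≤maximum : ∀ {k} .{{_ : NonZero k}} (f : Fin k → ℕ) i → f i ≤ maximum f
f≤maximum {suc zero}    f zero    = ≤-refl
f≤maximum {suc (suc k)} f zero    = m≤m⊔n _ _
f≤maximum {suc (suc k)} f (suc i) = ≤-trans (f≤maximum (f ∘ suc) i) (m≤n⊔m _ _)

minimum≤f : ∀ {k} .{{_ : NonZero k}} (f : Fin k → ℕ) i → minimum f ≤ f i
minimum≤f {suc zero}    f zero    = ≤-refl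
minimum≤f {suc (suc k)} f zero    = m⊓n≤m _ _
minimum≤f {suc (suc k)} f (suc i) = ≤-trans (m⊓n≤n _ _) (minimum≤f (f ∘ suc) i)

-- Degrees in the 2-section

module _ (H : Hypergraph) where

  excess : Fin (size H) → ℕ
  excess i = ∣ edge H i ∣ ∸ 1

  1+excess : ∀ i → suc (excess i) ≡ ∣ edge H i ∣
  1+excess i = m+[n∸m]≡n (x∈p⇒0<∣p∣ (proj₂ (edge-nonempty H i)))

  private
    b : Fin (order H) → Fin (size H) → ℕ
    b x i = χ (edge H i) x

  χ² : ∀ x i → b x i * b x i ≡ b x i
  χ² x i with lookup (edge H i) x
  ... | true  = refl
  ... | false = refl

  codegree-diag : ∀ x → codegree H x x ≡ sum (b x)
  codegree-diag x = trans (count-∈∈ x x (edge H)) (sum-cong-≗ (χ² x))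

  -- The diagonal, where `sectionMult` vanishes, is filled in so that sums over `y` need no case
  -- distinction.
  mult-split : ∀ x y → sectionMult H x y + χ ⁅ x ⁆ y * codegree H x x ≡ codegree H x y
  mult-split x y with x ≟ᶠ y
  ... | yes refl rewrite χ-∈ (x∈⁅x⁆ x) = +-identityʳ _
  ... | no x≢y   rewrite χ-∉ (x≢y⇒x∉⁅y⁆ (x≢y ∘ sym)) = +-identityʳ _

  sum-codegree : ∀ x → sum (codegree H x) ≡ sum (λ i → b x i * ∣ edge H i ∣)
  sum-codegree x = begin
    sum (codegree H x)                            ≡⟨ sum-cong-≗ (λ y → count-∈∈ x y (edge H)) ⟩
    sum (λ y → sum (λ i → b x i * b y i))         ≡⟨ ∑-comm (λ y i → b x i * b y i) ⟩
    sum (λ i → sum (λ y → b x i * b y i))         ≡⟨ sum-cong-≗ (λ i → *-distribˡ-sum (b x i) (χ (edge H i))) ⟨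
    sum (λ i → b x i * sum (χ (edge H i)))        ≡⟨ sum-cong-≗ (λ i → cong (b x i *_) (sum-χ (edge H i))) ⟩
    sum (λ i → b x i * ∣ edge H i ∣)              ∎
    where open ≡-Reasoning

  -- Each hyperedge through `x` adds its size to the sum of codegrees, one unit of which comes from
  -- `y = x`. That unit is added on both sides and cancelled, which avoids truncated subtraction.
  degree≡sum-excess : ∀ x → degree [ H ]₂ x ≡ sum (λ i → b x i * excess i)
  degree≡sum-excess x = +-cancelʳ-≡ (sum (b x)) _ _ (begin
    degree [ H ]₂ x + sum (b x)
      ≡⟨ cong (degree [ H ]₂ x +_) one ⟨
    degree [ H ]₂ x + sum (λ y → χ ⁅ x ⁆ y * codegree H x x)
      ≡⟨ ∑-distrib-+ (sectionMult H x) (λ y → χ ⁅ x ⁆ y * codegree H x x) ⟨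
    sum (λ y → sectionMult H x y + χ ⁅ x ⁆ y * codegree H x x)
      ≡⟨ sum-cong-≗ (mult-split x) ⟩
    sum (codegree H x)
      ≡⟨ sum-codegree x ⟩
    sum (λ i → b x i * ∣ edge H i ∣)
      ≡⟨ sum-cong-≗ (λ i → trans (cong (b x i *_) (sym (1+excess i)))
                             (trans (*-suc (b x i) (excess i)) (+-comm (b x i) _))) ⟩
    sum (λ i → b x i * excess i + b x i)
      ≡⟨ ∑-distrib-+ (λ i → b x i * excess i) (b x) ⟩
    sum (λ i → b x i * excess i) + sum (b x) ∎)
    where
    open ≡-Reasoning
    one : sum (λ y → χ ⁅ x ⁆ y * codegree H x x) ≡ sum (b x)
    one = begin
      sum (λ y → χ ⁅ x ⁆ y * codegree H x x) ≡⟨ *-distribʳ-sum (codegree H x x) (χ ⁅ x ⁆) ⟨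
      sum (χ ⁅ x ⁆) * codegree H x x         ≡⟨ cong (_* codegree H x x) (trans (sum-χ ⁅ x ⁆) (∣⁅x⁆∣≡1 x)) ⟩
      1 * codegree H x x                     ≡⟨ *-identityˡ _ ⟩
      codegree H x x                         ≡⟨ codegree-diag x ⟩
      sum (b x)                              ∎

  -- After exchanging the sums, each hyperedge is counted once for every vertex that it shares with
  -- `e`.
  sum-degree : ∀ e → sum (λ x → b x e * degree [ H ]₂ x) ≡
    sum (λ i → ∣ edge H e ∩ edge H i ∣ * excess i)
  sum-degree e = begin
    sum (λ x → b x e * degree [ H ]₂ x)
      ≡⟨ sum-cong-≗ (λ x → trans (cong (b x e *_) (degree≡sum-excess x))
                             (trans (*-distribˡ-sum (b x e) (λ i → b x i * excess i))
                               (sum-cong-≗ λ i → sym (*-assoc (b x e) (b x i) (excess i))))) ⟩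
    sum (λ x → sum (λ i → b x e * b x i * excess i))
      ≡⟨ ∑-comm (λ x i → b x e * b x i * excess i) ⟩
    sum (λ i → sum (λ x → b x e * b x i * excess i))
      ≡⟨ sum-cong-≗ (λ i → sym (*-distribʳ-sum (excess i) (λ x → b x e * b x i))) ⟩
    sum (λ i → sum (λ x → b x e * b x i) * excess i)
      ≡⟨ sum-cong-≗ (λ i → cong (_* excess i) (sum-χ* (edge H e) (edge H i))) ⟩
    sum (λ i → ∣ edge H e ∩ edge H i ∣ * excess i) ∎
    where open ≡-Reasoning

-- The intersection graph of the hyperedges

  meets? : ∀ i → Decidable λ j → i ≢ j × Nonempty (edge H i ∩ edge H j)
  meets? i j = ¬? (i ≟ᶠ j) ×-dec nonempty? (edge H i ∩ edge H j)

  neighbours : Fin (size H) → Subset (size H)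
  neighbours i = ⟦ meets? i ⟧

  ∈neighbours⁺ : ∀ {i j x} → i ≢ j → x ∈ edge H i → x ∈ edge H j → j ∈ neighbours i
  ∈neighbours⁺ {i} i≢j x∈i x∈j = ∈⟦⟧⁺ (meets? i) (i≢j , _ , x∈p∩q⁺ (x∈i , x∈j))

  ∈neighbours⁻ : ∀ {i j} → j ∈ neighbours i → i ≢ j × ∃ λ x → x ∈ edge H i × x ∈ edge H j
  ∈neighbours⁻ {i} j∈ with ∈⟦⟧⁻ (meets? i) j∈
  ... | i≢j , x , x∈ = i≢j , x , x∈p∩q⁻ _ _ x∈

  neighbours-sym : ∀ {i j} → j ∈ neighbours i → i ∈ neighbours j
  neighbours-sym j∈ with ∈neighbours⁻ j∈
  ... | i≢j , _ , x∈i , x∈j = ∈neighbours⁺ (i≢j ∘ sym) x∈j x∈i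

  neighbours-irrefl : ∀ {i} → i ∉ neighbours i
  neighbours-irrefl i∈ = proj₁ (∈neighbours⁻ i∈) refl

  star : Fin (order H) → Subset (size H)
  star x = ⟦ (λ i → x ∈? edge H i) ⟧

  star-card : ∀ x → sum (b x) ≡ ∣ star x ∣
  star-card x = trans (sum-cong-≗ same) (sum-χ (star x))
    where
    same : ∀ i → b x i ≡ χ (star x) i
    same i with x ∈? edge H i
    ... | yes x∈ = trans (χ-∈ x∈) (sym (χ-∈ (∈⟦⟧⁺ (λ i → x ∈? edge H i) x∈)))
    ... | no  x∉ = trans (χ-∉ x∉) (sym (χ-∉ (x∉ ∘ ∈⟦⟧⁻ (λ i → x ∈? edge H i))))

  -- Hyperedges with more than `D` neighbours

  module _ {D k : ℕ} (degree≤D : ∀ x → degree [ H ]₂ x ≤ D) (k≤ : ∀ i → k ≤ ∣ edge H i ∣)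
    (D<k² : D < k * k) (0<excess : ∀ i → 0 < excess i) where

    -- A hyperedge with at least D + 1 neighbours in S, all of them at least as large,
    -- attains equality throughout the double count.
    record Tight (S : Subset (size H)) (e : Fin (size H)) : Set where
      field
        size≡k       : ∣ edge H e ∣ ≡ k
        1+D≡k²       : suc D ≡ k * k
        degree≡      : ∣ neighbours e ∩ S ∣ ≡ suc D
        neighbour∈S  : ∀ {i} → i ∈ neighbours e → i ∈ S
        neighbour≡k  : ∀ {i} → i ∈ neighbours e → ∣ edge H i ∣ ≡ k
        neighbour∩≡1 : ∀ {i} → i ∈ neighbours e → ∣ edge H e ∩ edge H i ∣ ≡ 1
        star≡1+k     : ∀ {x} → x ∈ edge H e → ∣ star x ∣ ≡ suc k

    module _ (S : Subset (size H)) (e : Fin (size H))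
      (larger : ∀ {i} → i ∈ neighbours e → i ∈ S → excess e ≤ excess i)
      (many : D < ∣ neighbours e ∩ S ∣) where

      private
        z s δ : ℕ
        z = excess e
        s = suc z
        δ = ∣ neighbours e ∩ S ∣

        instance
          z≢0 : NonZero z
          z≢0 = >-nonZero (0<excess e)

        meet : Fin (size H) → ℕ
        meet i = ∣ edge H e ∩ edge H i ∣

        -- The guaranteed contribution of `i` to the double count: `e` itself gives its size times
        -- its excess, a neighbour in `S` at least one common point times `z`, any other hyperedge
        -- possibly nothing.
        low : Fin (size H) → ℕ
        low i = χ ⁅ e ⁆ i * (s * z) + χ (neighbours e ∩ S) i * z

        0<meet : ∀ {i} → i ∈ neighbours e → 0 < meet i
        0<meet i∈ with ∈neighbours⁻ i∈
        ... | _ , x , x∈e , x∈i = x∈p⇒0<∣p∣ (x∈p∩q⁺ (x∈e , x∈i))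

        low-e : low e ≡ s * z
        low-e rewrite χ-∈ (x∈⁅x⁆ e)
          | χ-∉ {p = neighbours e ∩ S} (λ e∈ → neighbours-irrefl (proj₁ (x∈p∩q⁻ _ _ e∈))) =
          trans (+-identityʳ _) (*-identityˡ _)

        low-∈ : ∀ {i} → i ∈ neighbours e → i ∈ S → low i ≡ z
        low-∈ i∈ i∈S rewrite χ-∉ (x≢y⇒x∉⁅y⁆ (proj₁ (∈neighbours⁻ i∈) ∘ sym))
          | χ-∈ (x∈p∩q⁺ (i∈ , i∈S)) = *-identityˡ z

        low-∉ : ∀ {i} → i ≢ e → i ∉ neighbours e ∩ S → low i ≡ 0
        low-∉ i≢e i∉ rewrite χ-∉ (x≢y⇒x∉⁅y⁆ i≢e) | χ-∉ i∉ = refl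

        low≤ : ∀ i → low i ≤ meet i * excess i
        low≤ i with i ≟ᶠ e | i ∈? neighbours e ∩ S
        ... | yes refl | _ = ≤-reflexive (trans low-e (cong (_* z)
                (trans (1+excess e) (sym (cong ∣_∣ (∩-idem (edge H e)))))))
        ... | no i≢e | no i∉ = subst (_≤ meet i * excess i) (sym (low-∉ i≢e i∉)) z≤n
        ... | no i≢e | yes i∈ with x∈p∩q⁻ _ _ i∈
        ...   | i∈N , i∈S = subst (_≤ meet i * excess i) (sym (low-∈ i∈N i∈S))
                (≤-trans (larger i∈N i∈S) (m≤n*m (excess i) (meet i) ⦃ >-nonZero (0<meet i∈N) ⦄))

        sum-low : sum low ≡ s * z + δ * z
        sum-low = begin
          sum low
            ≡⟨ ∑-distrib-+ (λ i → χ ⁅ e ⁆ i * (s * z)) (λ i → χ (neighbours e ∩ S) i * z) ⟩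
          sum (λ i → χ ⁅ e ⁆ i * (s * z)) + sum (λ i → χ (neighbours e ∩ S) i * z)
            ≡⟨ cong₂ _+_ (*-distribʳ-sum (s * z) (χ ⁅ e ⁆))
                         (*-distribʳ-sum z (χ (neighbours e ∩ S))) ⟨
          sum (χ ⁅ e ⁆) * (s * z) + sum (χ (neighbours e ∩ S)) * z
            ≡⟨ cong₂ (λ u v → u * (s * z) + v * z)
                 (trans (sum-χ ⁅ e ⁆) (∣⁅x⁆∣≡1 e)) (sum-χ (neighbours e ∩ S)) ⟩
          1 * (s * z) + δ * z
            ≡⟨ cong (_+ δ * z) (*-identityˡ (s * z)) ⟩
          s * z + δ * z ∎
          where open ≡-Reasoning

        sum-bD : sum (λ x → b x e * D) ≡ s * D
        sum-bD = trans (sym (*-distribʳ-sum D (χ (edge H e))))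
          (cong (_* D) (trans (sum-χ (edge H e)) (sym (1+excess e))))

        sum-meet≤ : sum (λ i → meet i * excess i) ≤ s * D
        sum-meet≤ = subst₂ _≤_ (sum-degree e) sum-bD
          (sum-mono-≤ λ x → *-monoʳ-≤ (b x e) (degree≤D x))

        bound : s * z + δ * z ≤ s * D
        bound = ≤-trans (≤-reflexive (sym sum-low)) (≤-trans (sum-mono-≤ low≤) sum-meet≤)

        -- Putting `D < δ` into `bound` leaves `z + z * s ≤ D`, whose left side is one less than
        -- `s * s`.
        s²≤1+D : s * s ≤ suc D
        s²≤1+D = s≤s (+-cancelʳ-≤ (z * D) _ _ (begin
          z + z * s + z * D     ≡⟨ arith z D ⟩
          s * z + suc D * z     ≤⟨ +-monoʳ-≤ (s * z) (*-monoˡ-≤ z many) ⟩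
          s * z + δ * z         ≤⟨ bound ⟩
          D + z * D             ∎))
          where
          open ≤-Reasoning
          arith : ∀ z D → z + z * suc z + z * D ≡ suc z * z + suc D * z
          arith = solve-∀

        k≤s : k ≤ s
        k≤s = subst (k ≤_) (sym (1+excess e)) (k≤ e)

        -- The chain `k * k ≤ s * s ≤ suc D ≤ k * k` closes up.
        1+D≡s² : suc D ≡ s * s
        1+D≡s² = ≤-antisym (≤-trans D<k² (*-mono-≤ k≤s k≤s)) s²≤1+D

        s≡k : s ≡ k
        s≡k with m≤n⇒m<n∨m≡n k≤s
        ... | inj₁ k<s = contradiction (≤-trans s²≤1+D D<k²) (<⇒≱ (*-mono-< k<s k<s))
        ... | inj₂ k≡s = sym k≡s

        D≡ : D ≡ z + z * s
        D≡ = suc-injective 1+D≡s²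

        -- As `D` is `z * (s + 1)`, the upper bound `s * D` is exactly what `low` sums to when `e`
        -- has `s * s` neighbours in `S`: no slack remains.
        s*D≡ : s * D ≡ s * z + s * s * z
        s*D≡ = trans (cong (s *_) D≡) (arith z)
          where
          arith : ∀ z → suc z * (z + z * suc z) ≡ suc z * z + suc z * suc z * z
          arith = solve-∀

        δ≡1+D : δ ≡ suc D
        δ≡1+D = ≤-antisym (subst (δ ≤_) (sym 1+D≡s²) (*-cancelʳ-≤ δ (s * s) z
          (+-cancelˡ-≤ (s * z) _ _ (subst (s * z + δ * z ≤_) s*D≡ bound)))) many

        s*D≡sum-low : s * D ≡ sum low
        s*D≡sum-low = trans s*D≡ (trans
          (cong (λ u → s * z + u * z) (trans (sym 1+D≡s²) (sym δ≡1+D))) (sym sum-low))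

        low≡ : ∀ i → low i ≡ meet i * excess i
        low≡ = sum-≤-antisym low≤ (subst (sum (λ i → meet i * excess i) ≤_) s*D≡sum-low sum-meet≤)

        -- A neighbour outside `S` would be worth nothing in `low` but a positive amount in the true
        -- count.
        ∈S : ∀ {i} → i ∈ neighbours e → i ∈ S
        ∈S {i} i∈ with i ∈? S
        ... | yes i∈S = i∈S
        ... | no  i∉S = contradiction
                (trans (sym (low≡ i)) (low-∉ (proj₁ (∈neighbours⁻ i∈) ∘ sym)
                                             (i∉S ∘ proj₂ ∘ x∈p∩q⁻ _ _)))
                (>⇒≢ (*-mono-≤ (0<meet i∈) (0<excess i)))

        meet*excess : ∀ {i} → i ∈ neighbours e → meet i * excess i ≡ z
        meet*excess {i} i∈ = trans (sym (low≡ i)) (low-∈ i∈ (∈S i∈))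

        excess≡z : ∀ {i} → i ∈ neighbours e → excess i ≡ z
        excess≡z {i} i∈ = ≤-antisym
          (subst (excess i ≤_) (meet*excess i∈)
            (m≤n*m (excess i) (meet i) ⦃ >-nonZero (0<meet i∈) ⦄))
          (larger i∈ (∈S i∈))

        meet≡1 : ∀ {i} → i ∈ neighbours e → meet i ≡ 1
        meet≡1 {i} i∈ = *-cancelʳ-≡ (meet i) 1 z
          (trans (cong (meet i *_) (sym (excess≡z i∈))) (trans (meet*excess i∈) (sym (*-identityˡ z))))

        -- The equality case on the vertex side: the degrees over `e` sum to at least `s * D`, and
        -- none exceeds `D`.
        degree≡D : ∀ {x} → x ∈ edge H e → degree [ H ]₂ x ≡ D
        degree≡D {x} x∈e = begin
          degree [ H ]₂ x           ≡⟨ *-identityˡ _ ⟨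
          1 * degree [ H ]₂ x       ≡⟨ cong (_* degree [ H ]₂ x) (χ-∈ x∈e) ⟨
          b x e * degree [ H ]₂ x   ≡⟨ sum-≤-antisym (λ x → *-monoʳ-≤ (b x e) (degree≤D x)) ΣD≤ x ⟩
          b x e * D                 ≡⟨ cong (_* D) (χ-∈ x∈e) ⟩
          1 * D                     ≡⟨ *-identityˡ D ⟩
          D                         ∎
          where
          open ≡-Reasoning
          ΣD≤ : sum (λ x → b x e * D) ≤ sum (λ x → b x e * degree [ H ]₂ x)
          ΣD≤ = subst₂ _≤_ (trans (sym s*D≡sum-low) (sym sum-bD)) (sym (sum-degree e))
                  (sum-mono-≤ low≤)

        -- All hyperedges through `x` are `e` or its neighbours and have excess `z`, so dividing the
        -- degree `D = (s + 1) * z` by `z` counts them.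
        star≡1+s : ∀ {x} → x ∈ edge H e → ∣ star x ∣ ≡ suc s
        star≡1+s {x} x∈e = trans (sym (star-card x)) (*-cancelʳ-≡ (sum (b x)) (suc s) z (begin
          sum (b x) * z                  ≡⟨ *-distribʳ-sum z (b x) ⟩
          sum (λ i → b x i * z)          ≡⟨ sum-cong-≗ same ⟨
          sum (λ i → b x i * excess i)   ≡⟨ degree≡sum-excess x ⟨
          degree [ H ]₂ x                ≡⟨ trans (degree≡D x∈e) D≡ ⟩
          z + z * s                      ≡⟨ cong (z +_) (*-comm z s) ⟩
          suc s * z                      ∎))
          where
          open ≡-Reasoning
          same : ∀ i → b x i * excess i ≡ b x i * z
          same i with x ∈? edge H i | i ≟ᶠ e
          ... | no x∉   | _ rewrite χ-∉ x∉ = refl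
          ... | yes _   | yes refl = refl
          ... | yes x∈i | no i≢e =
                  cong (b x i *_) (excess≡z (∈neighbours⁺ (i≢e ∘ sym) x∈e x∈i))

      tight : Tight S e
      tight = record
        { size≡k       = trans (sym (1+excess e)) s≡k
        ; 1+D≡k²       = trans 1+D≡s² (cong₂ _*_ s≡k s≡k)
        ; degree≡      = δ≡1+D
        ; neighbour∈S  = ∈S
        ; neighbour≡k  = λ {i} i∈ → trans (sym (1+excess i)) (trans (cong suc (excess≡z i∈)) s≡k)
        ; neighbour∩≡1 = meet≡1
        ; star≡1+k     = λ x∈e → trans (star≡1+s x∈e) (cong suc s≡k)
        }

    -- From tight hyperedges to Brooks' theorem

    open Brooks {d = D} neighbours neighbours-sym neighbours-irrefl
    open Tight

    -- Induction on the excess supplies the comparison of sizes that `tight` requires: a smaller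
    -- neighbour in `S` is already tight, which forces `v` to have the least possible size `k`.
    all-tight : ∀ {S} → (∀ {v} → v ∈ S → D < ∣ neighbours v ∩ S ∣) → ∀ {v} → v ∈ S → Tight S v
    all-tight {S} many {v} v∈S = go (suc (excess v)) v∈S ≤-refl
      where
      go : ∀ n {v} → v ∈ S → excess v < n → Tight S v
      go (suc n) {v} v∈S <n = tight S v larger (many v∈S)
        where
        larger : ∀ {i} → i ∈ neighbours v → i ∈ S → excess v ≤ excess i
        larger {i} i∈ i∈S with excess v ≤? excess i
        ... | yes v≤i = v≤i
        ... | no  v≰i = ∸-monoˡ-≤ 1 (subst (_≤ ∣ edge H i ∣)
                (sym (neighbour≡k (go n i∈S (≤-trans (≰⇒> v≰i) (s≤s⁻¹ <n))) (neighbours-sym i∈)))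
                (k≤ i))

    -- The induced path is `g`, `e`, `f`, with `g` through `x`, `f` through `y` and `f`, `g`
    -- disjoint. The degree `k * k` is at least 4, which leaves a third neighbour `v` of `e`.
    tight⇒saturated : ∀ {S} → Nonempty S → (∀ {v} → v ∈ S → Tight S v) → Saturated S
    tight⇒saturated {S} (e , e∈S) T = (λ v∈S → ≤-reflexive (degree≡ (T v∈S))) , path
      where
      1<∣e∣ : 1 < ∣ edge H e ∣
      1<∣e∣ = subst (1 <_) (1+excess e) (s≤s (0<excess e))
      1<k : 1 < k
      1<k = subst (1 <_) (size≡k (T e∈S)) 1<∣e∣
      2<deg : 2 < ∣ neighbours e ∩ S ∣
      2<deg = subst (2 <_) (trans (sym (1+D≡k² (T e∈S))) (sym (degree≡ (T e∈S))))
                (≤-trans (s≤s (s≤s (s≤s z≤n))) (*-mono-≤ 1<k 1<k))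
      linear : ∀ {i j u v} → i ∈ S → i ≢ j → u ≢ v →
        u ∈ edge H i → v ∈ edge H i → u ∈ edge H j → v ∉ edge H j
      linear i∈S i≢j u≢v u∈i v∈i u∈j v∈j = <⇒≢
        (x≢y⇒1<∣p∣ (x∈p∩q⁺ (u∈i , u∈j)) (x∈p∩q⁺ (v∈i , v∈j)) u≢v)
        (sym (neighbour∩≡1 (T i∈S) (∈neighbours⁺ i≢j u∈i u∈j)))
      path : ∃₂ λ v₁ v₂ → ∃₂ λ v₃ v₄ →
        (v₁ ∈ S × v₂ ∈ S × v₃ ∈ S × v₄ ∈ S) ×
        (Adjacent v₂ v₁ × Adjacent v₂ v₃ × Adjacent v₂ v₄) ×
        v₁ ≢ v₃ × v₄ ≢ v₁ × v₄ ≢ v₃ × ¬ Adjacent v₁ v₃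
      path with edge-nonempty H e
      ... | x , x∈e with 1<∣p∣⇒∃≢ (edge H e) x 1<∣e∣
      ... | y , y∈e , y≢x
        with 1<∣p∣⇒∃≢ (star y) e (subst (1 <_) (sym (star≡1+k (T e∈S) y∈e)) (m≤n⇒m≤1+n 1<k))
      ... | f , f∈star , f≢e = induced (any? λ g → (g ∈? star x) ×-dec ¬? (nonempty? (edge H f ∩ edge H g)))
        where
        in-star : ∀ {x i} → i ∈ star x → x ∈ edge H i
        in-star {x} = ∈⟦⟧⁻ (λ i → x ∈? edge H i)
        y∈f : y ∈ edge H f
        y∈f = in-star f∈star
        e~f : f ∈ neighbours e
        e~f = ∈neighbours⁺ (f≢e ∘ sym) y∈e y∈f
        x∉f : x ∉ edge H f
        x∉f = linear e∈S (f≢e ∘ sym) y≢x y∈e x∈e y∈f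
        star⊆S : ∀ {i} → i ∈ star x → i ∈ S
        star⊆S {i} i∈ with i ≟ᶠ e
        ... | yes refl = e∈S
        ... | no i≢e = neighbour∈S (T e∈S) (∈neighbours⁺ (i≢e ∘ sym) x∈e (in-star i∈))
        induced : Dec (∃ λ g → g ∈ star x × Empty (edge H f ∩ edge H g)) → _
        -- The repeated point `u` lies on `f` and so differs from `x`: two hyperedges through `x`
        -- would share two points.
        induced (no none)
          with pigeonhole-⊆ (λ i u → u ∈? edge H i) (star x) (edge H f)
                 (≤-reflexive (trans (cong suc (neighbour≡k (T e∈S) e~f)) (sym (star≡1+k (T e∈S) x∈e))))
                 (λ {i} i∈ → case nonempty? (edge H f ∩ edge H i) of
                   λ { (yes (u , u∈)) → u , x∈p∩q⁻ _ _ u∈ ; (no e) → contradiction (i , i∈ , e) none })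
        ... | i , i′ , u , i∈ , i′∈ , i≢i′ , u∈f , u∈i , u∈i′ =
          contradiction u∈i′ (linear (star⊆S i∈) i≢i′ (λ { refl → x∉f u∈f })
                               (in-star {x} i∈) u∈i (in-star {x} i′∈))
        induced (yes (g , g∈ , f∩g=∅)) with 2<∣p∣⇒∃≢≢ (neighbours e ∩ S) g f 2<deg
        ... | v , v∈ , v≢g , v≢f with x∈p∩q⁻ _ _ v∈
        ... | e~v , v∈S = g , e , f , v
          , (star⊆S g∈ , e∈S , neighbour∈S (T e∈S) e~f , v∈S)
          , (∈neighbours⁺ (λ { refl → f∩g=∅ (y , x∈p∩q⁺ (y∈f , y∈e)) }) x∈e (in-star g∈) , e~f , e~v)
          , (λ { refl → f∩g=∅ (y , x∈p∩q⁺ (y∈f , y∈f)) }) , v≢g , v≢f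
          , λ g~f → case ∈neighbours⁻ g~f of
              λ (_ , u , u∈g , u∈f) → f∩g=∅ (u , x∈p∩q⁺ (u∈f , u∈g))

    reducible⊎saturated : ∀ S → Nonempty S →
      (∃ λ v → v ∈ S × ∣ neighbours v ∩ S ∣ < suc D) ⊎ Saturated S
    reducible⊎saturated S ne with any? (λ v → (v ∈? S) ×-dec (∣ neighbours v ∩ S ∣ <? suc D))
    ... | yes v  = inj₁ v
    ... | no  ¬v = inj₂ (tight⇒saturated ne (all-tight λ {v} v∈S → ≮⇒≥ λ < → ¬v (v , v∈S , <)))

    colourable : Colourable H (suc D)
    colourable with brooks reducible⊎saturated ⊤
    ... | c , proper = c , λ i j ci≡cj → case i ≟ᶠ j of λ
      { (yes i≡j) → inj₂ (cong (edge H) i≡j)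
      ; (no  i≢j) → inj₁ λ { (x , x∈) → case x∈p∩q⁻ _ _ x∈ of
          λ (x∈i , x∈j) → proper ∈⊤ ∈⊤ (∈neighbours⁺ i≢j x∈i x∈j) ci≡cj } }

theorem1 : (H : Hypergraph) → Loopless H →
    antirank H ^ 2 ≥ Δ [ H ]₂ + 1 →
    q H ≤ Δ [ H ]₂ + 1
theorem1 H loopless antirank²≥ = proj₂ (q-isLeast H) _
  (subst (Colourable H) (sym 1+Δ) (colourable H {k = antirank H}
    (f≤maximum (degree [ H ]₂)) (minimum≤f (λ i → ∣ edge H i ∣))
    -- The square unfolds to `antirank H * (antirank H * 1)`, and `D < k * k` is the hypothesis with
    -- `Δ [ H ]₂ + 1` read as a successor.
    (subst₂ _≤_ 1+Δ (cong (antirank H *_) (*-identityʳ (antirank H))) antirank²≥)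
    λ i → n≢0⇒n>0 λ excess≡0 → loopless i (trans (sym (1+excess H i)) (cong suc excess≡0))))
  where
  1+Δ : Δ [ H ]₂ + 1 ≡ suc (Δ [ H ]₂)
  1+Δ = +-comm _ 1
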